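{- Let $V_n$ ($n\ge 1$) be the supervector of the $n$-th generation supertiles of the hat tile whose short edge has length $1$, and let $V_0=3V_1-V_2$, as defined in the context. Then $$V_n=\left(F_{2n},\ \sqrt{3}\,L_{2n}\right)\qquad\text{for all } n\ge 0 .$$ Moreover, for every $n\ge 1$, the $n$-th generation of supertiles rotates from the $(n-1)$-th by an angle of $\operatorname{arccot}(G_n\sqrt{3})$ (that is, the clockwise angle from the direction of $V_{n-1}$ to the direction of $V_n$ equals $\operatorname{arccot}(G_n\sqrt3)$), where $$G_n=\frac{8L_{4n-2}+21}{15}.$$
   Context: $F_n$ is the Fibonacci sequence ($F_0=0$, $F_1=1$, $F_{n}=F_{n-1}+F_{n-2}$) and $L_n$ the Lucas sequence ($L_0=2$, $L_1=1$, $L_n=L_{n-1}+L_{n-2}$). The function $\operatorname{arccot}$ of a positive number takes values in $(0,\pi/2)$. Identify the plane with $\mathbb{C}$, $(x,y)\leftrightarrow x+iy$, and put $\omega=e^{i\pi/3}$. The supertiles of the hat tile (the aperiodic monotile $\mathrm{Tile}(1,\sqrt3)$, short edge $1$) come in two types in each generation $m\ge1$: hat-$m$ and thc-$m$ (two-hat compound). Hat-1 is a single hat and thc-1 is the two-hat compound. Every supertile of generation $m$ carries a directed segment, its supervector, whose start and end are called its tail and head; it is the same vector for hat-$m$ and thc-$m$. In standard orientation it is the vector $V_m$, with complex number $v_m$. A copy of a generation-$m$ supertile with rotation $u$ ($u\in\mathbb{C}$, $|u|=1$) and tail $p$ has supervector from $p$ to $p+u\,v_m$. Only these markings are needed. Composition.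 For $m\ge2$, a hat-$m$ of rotation $u$ consists of one thc-$(m-1)$, called $C$, and six hat-$(m-1)$'s, called $H_1,\dots,H_6$, placed as follows. $C$ has rotation $u$; call its tail $o$. $H_1$ has tail $o$ and rotation $u\omega^{ -2}$. $H_2$ has its tail at the head of $H_1$ and rotation $u\omega^{ -1}$. $H_3$ has its tail at the head of $H_2$ and rotation $u$. $H_4$ has rotation $u$ and is placed between $C$ and $H_3$. $H_5$ has its tail at the head of $H_4$ and rotation $u\omega$. $H_6$ has its tail at the head of $H_5$ and rotation $u\omega^2$. A thc-$m$ is the same except that $H_3$ is missing. For $m\ge3$ the position of $H_4$ is determined by this rule: the supervector of the constituent thc-$(m-2)$ of $H_4$ lies exactly where the supervector of the missing third hat-$(m-2)$ (the missing $H_3$) of $C$, a thc-$(m-1)$, would be. Supervectors. - Generation 1: $V_1=(1,3\sqrt3)$. - Generation 2: $V_2=(3,7\sqrt3)$, and in a generation-2 supertile of rotation $u$ the tail of the supervector is at $o+u\,T_2$ with $T_2=2-2\sqrt3\,i$, where $o$ is the tail of its constituent thc-1. - Generation $m\ge3$: the supervector starts at the head of the third hat-$(m-2)$ (the $H_3$ constituent) of the first hat-$(m-1)$ (i.e. $H_1$) and ends at the head of the third hat-$(m-2)$ of the fifth hat-$(m-1)$ (i.e. $H_5$). The vector $V_m$ is this vector when $u=1$. Finally, $V_0:=3V_1-V_2=(0,2\sqrt3)$. -}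

module Defs where

open import Level using (Level; suc; _⊔_)
open import Algebra.Apartness.Structures using (IsHeytingField)
open import Algebra.Bundles using (CommutativeRing)
open import Algebra.Core using (Op₁; Op₂)
import Algebra.Definitions.RawMonoid as RawMonoidMultiples
import Algebra.Properties.AbelianGroup as AbelianGroupProperties
import Relation.Binary.Reasoning.Setoid as SetoidReasoning
open import Data.Nat as ℕ using (ℕ; zero; NonZero)
open import Data.Product using (_×_; _,_; Σ-syntax; ∃-syntax; proj₁; proj₂)
open import Data.Sum using (_⊎_; inj₁; inj₂)
open import Relation.Binary.Core using (Rel)
open import Relation.Binary.Structures using (IsStrictPartialOrder)
open import Relation.Nullary using (¬_)

fib : ℕ → ℕ
fib 0 = 0
fib 1 = 1
fib (ℕ.suc (ℕ.suc n)) = fib (ℕ.suc n) ℕ.+ fib n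

lucas : ℕ → ℕ
lucas 0 = 2
lucas 1 = 1
lucas (ℕ.suc (ℕ.suc n)) = lucas (ℕ.suc n) ℕ.+ lucas n

-- Apartness is  x < y ⊎ y < x ; no trichotomy is assumed, so constructive
-- models of ℝ are covered as well as the classical one.
record OrderedField c ℓ₁ ℓ₂ : Set (suc (c ⊔ ℓ₁ ⊔ ℓ₂)) where
  infix  8 -_
  infixl 7 _*_ _÷_
  infixl 6 _+_ _-_
  infix  4 _≈_ _<_ _≤_ _#_
  field
    Carrier : Set c
    _≈_     : Rel Carrier ℓ₁
    _<_     : Rel Carrier ℓ₂
    _+_     : Op₂ Carrier
    _*_     : Op₂ Carrier
    -_      : Op₁ Carrier
    0#      : Carrier
    1#      : Carrier

  _#_ : Rel Carrier ℓ₂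
  x # y = x < y ⊎ y < x

  field
    isHeytingField       : IsHeytingField _≈_ _#_ _+_ _*_ -_ 0# 1#
    isStrictPartialOrder : IsStrictPartialOrder _≈_ _<_
    0<1                  : 0# < 1#
    +-monoˡ-<            : ∀ {x y} z → x < y → x + z < y + z
    *-positive           : ∀ {x y} → 0# < x → 0# < y → 0# < x * y

  module HF = IsHeytingField isHeytingField
  module SPO = IsStrictPartialOrder isStrictPartialOrder

  commutativeRing : CommutativeRing c ℓ₁
  commutativeRing = record { isCommutativeRing = HF.isCommutativeRing }

  module CR = CommutativeRing commutativeRing

  _-_ : Op₂ Carrier
  x - y = x + (- y)

  _≤_ : Rel Carrier ℓ₂
  x ≤ y = ¬ (y < x)

  open RawMonoidMultiples CR.+-rawMonoid using () renaming (_×_ to _·_)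

  fromℕ : ℕ → Carrier
  fromℕ n = n · 1#

  0<fromℕ-suc : ∀ n → 0# < fromℕ (ℕ.suc n)
  0<fromℕ-suc zero = SPO.<-respʳ-≈ (CR.sym (CR.+-identityʳ 1#)) 0<1
  0<fromℕ-suc (ℕ.suc n) = SPO.trans (0<fromℕ-suc n)
    (SPO.<-respˡ-≈ (CR.+-identityˡ _) (+-monoˡ-< (fromℕ (ℕ.suc n)) 0<1))

  1/ : ∀ n → .{{NonZero n}} → Carrier
  1/ (ℕ.suc n) = proj₁ (HF.#⇒invertible {fromℕ (ℕ.suc n)} {0#} (inj₂ (0<fromℕ-suc n)))

  _÷_ : Carrier → ∀ n → .{{NonZero n}} → Carrier
  x ÷ n = x * 1/ n

-- The real numbers: the complete Archimedean ordered field, with the elementary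
-- functions used.  Partial functions (√, arccot on positive reals) are totalised;
-- nothing is assumed about their values outside the positive reals.
record RealNumbers c ℓ₁ ℓ₂ : Set (suc (c ⊔ ℓ₁ ⊔ ℓ₂)) where
  field
    orderedField : OrderedField c ℓ₁ ℓ₂

  open OrderedField orderedField public

  field
    archimedean : ∀ x → ∃[ n ] x < fromℕ n

    -- If |f m - f n| < 1/(k+1) for all m, n ≥ k, then some l satisfies
    -- |f n - l| ≤ 1/(k+1) for all n ≥ k.
    complete : (f : ℕ → Carrier) →
      (∀ k m n → k ℕ.≤ m → k ℕ.≤ n → fromℕ (ℕ.suc k) * (f m - f n) < 1#) →
      ∃[ l ] (∀ k n → k ℕ.≤ n →
        fromℕ (ℕ.suc k) * (f n - l) ≤ 1# × fromℕ (ℕ.suc k) * (l - f n) ≤ 1#)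

    √_         : Op₁ Carrier
    √-cong     : ∀ {x y} → x ≈ y → √ x ≈ √ y
    √-positive : ∀ {x} → 0# < x → 0# < √ x
    √-square   : ∀ {x} → 0# < x → √ x * √ x ≈ x

    -- These laws determine cos, sin and π: by the addition formulas and the
    -- bounds, cos′ = - sin and sin′ = cos, and π/2 is the least positive zero
    -- of cos.
    cos sin  : Op₁ Carrier
    π        : Carrier
    cos-cong : ∀ {x y} → x ≈ y → cos x ≈ cos y
    sin-cong : ∀ {x y} → x ≈ y → sin x ≈ sin y
    cos-0    : cos 0# ≈ 1#
    sin-0    : sin 0# ≈ 0#
    cos-+    : ∀ x y → cos (x + y) ≈ cos x * cos y - sin x * sin y
    sin-+    : ∀ x y → sin (x + y) ≈ sin x * cos y + cos x * sin y
    cos²+sin² : ∀ x → cos x * cos x + sin x * sin x ≈ 1#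
    0<π      : 0# < π
    cos-π/2  : cos (π ÷ 2) ≈ 0#
    cos-positive : ∀ {x} → 0# < x → x < π ÷ 2 → 0# < cos x
    sin-lower    : ∀ {x} → 0# < x → x < π ÷ 2 → x * cos x < sin x
    sin-upper    : ∀ {x} → 0# < x → x < π ÷ 2 → sin x < x

    -- arccot x, for x > 0, is the angle in (0, π/2) whose cotangent is x.
    arccot          : Op₁ Carrier
    arccot-cong     : ∀ {x y} → x ≈ y → arccot x ≈ arccot y
    arccot-positive : ∀ {x} → 0# < x → 0# < arccot x
    arccot-<π/2     : ∀ {x} → 0# < x → arccot x < π ÷ 2
    cot-arccot      : ∀ {x} → 0# < x → cos (arccot x) ≈ x * sin (arccot x)

module Plane {c ℓ₁ ℓ₂} (ℝ : RealNumbers c ℓ₁ ℓ₂) where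
  open RealNumbers ℝ

  infixl 7 _*ᶜ_
  infixl 6 _+ᶜ_ _-ᶜ_
  infix  4 _≈ᶜ_
  infix  5 _+i_

  record ℂ : Set c where
    constructor _+i_
    field
      re im : Carrier

  open ℂ public

  _≈ᶜ_ : Rel ℂ ℓ₁
  z ≈ᶜ w = re z ≈ re w × im z ≈ im w

  _+ᶜ_ _-ᶜ_ _*ᶜ_ : Op₂ ℂ
  z +ᶜ w = (re z + re w) +i (im z + im w)
  z -ᶜ w = (re z - re w) +i (im z - im w)
  z *ᶜ w = (re z * re w - im z * im w) +i (re z * im w + im z * re w)

  real : Carrier → ℂ
  real x = x +i 0#

  0ᶜ 1ᶜ : ℂ
  0ᶜ = real 0#
  1ᶜ = real 1#

  -- e^{iθ}
  cis : Carrier → ℂ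
  cis θ = cos θ +i sin θ

  -- θ ∈ [0, 2π) and w is a positive multiple of z e^{-iθ}; for z, w ≠ 0 this
  -- says that θ is the clockwise angle from the direction of z to that of w.
  IsClockwiseAngle : Carrier → ℂ → ℂ → Set (c ⊔ ℓ₁ ⊔ ℓ₂)
  IsClockwiseAngle θ z w =
    0# ≤ θ × θ < fromℕ 2 * π ×
    ∃[ r ] (0# < r × w ≈ᶜ real r *ᶜ (z *ᶜ cis (- θ)))

module Supertiles {c ℓ₁ ℓ₂} (ℝ : RealNumbers c ℓ₁ ℓ₂) where
  open RealNumbers ℝ
  open Plane ℝ

  √3 : Carrier
  √3 = √ (fromℕ 3)

  ω ω⁻¹ : ℂ
  ω   = cis (π ÷ 3)
  ω⁻¹ = cis (- (π ÷ 3))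

  -- A copy of a supertile, reduced to its marking: the supervector runs from
  -- the tail p to p + u v, where u is the rotation and v the standard
  -- supervector of its generation, which hat-m and thc-m share.
  record Copy : Set c where
    constructor copy
    field
      rotation tail : ℂ

  open Copy public

  head : (v : ℂ) → Copy → ℂ
  head v X = tail X +ᶜ rotation X *ᶜ v

  -- The constituents H₁, H₂, H₃ are located relative to the constituent C,
  -- which has the rotation of the whole supertile; v is the supervector of the
  -- constituents' generation.  In a thc, H₃ is the vacant place.
  H₁ : Copy → Copy
  H₁ C = copy (rotation C *ᶜ (ω⁻¹ *ᶜ ω⁻¹)) (tail C)

  H₂ H₃ : (v : ℂ) → Copy → Copy
  H₂ v C = copy (rotation C *ᶜ ω⁻¹) (head v (H₁ C))
  H₃ v C = copy (rotation C) (head v (H₂ v C))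

  -- The data of generations m-1 and m, where m ≥ 2, from which generation m+1
  -- is built: v⁻ = V_{m-1}, v = V_m, and t = T_m, meaning that a generation-m
  -- supertile of rotation u whose constituent thc has tail o has its own tail
  -- at o + u t.
  record Markings : Set c where
    field
      v⁻ v t : ℂ

  module Composition (M : Markings) where
    open Markings M

    -- Inside a copy of generation m: the constituent thc-(m-1), and the place
    -- of the third hat-(m-1), which is vacant if the copy is a thc-m.
    thcOf thirdOf : Copy → Copy
    thcOf X = copy (rotation X) (tail X -ᶜ rotation X *ᶜ t)
    thirdOf X = H₃ v⁻ (thcOf X)

    -- The remaining constituents of a supertile of generation m+1 whose
    -- constituent thc-m is C.  H₄ is the translate, with the rotation of C, for
    -- which thcOf (H₄ C) lies at the vacant place of C; see H₄-rule.
    H₄ H₅ H₆ : Copy → Copy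
    H₄ C = copy (rotation C)
                (tail (thirdOf C) -ᶜ tail (thcOf (copy (rotation C) 0ᶜ)))
    H₅ C = copy (rotation C *ᶜ ω) (head v (H₄ C))
    H₆ C = copy (rotation C *ᶜ (ω *ᶜ ω)) (head v (H₅ C))

    H₄-rule : ∀ C → rotation (thcOf (H₄ C)) ≈ᶜ rotation (thirdOf C)
                  × tail (thcOf (H₄ C)) ≈ᶜ tail (thirdOf C)
    H₄-rule C = (CR.refl , CR.refl) , (cancel _ _ , cancel _ _)
      where
      open AbelianGroupProperties CR.+-abelianGroup using (⁻¹-involutive)
      open SetoidReasoning CR.setoid
      cancel : ∀ a b → a - (0# - b) - b ≈ a
      cancel a b = begin
        a - (0# - b) - b  ≈⟨ CR.+-congʳ (CR.+-congˡ (CR.-‿cong (CR.+-identityˡ _))) ⟩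
        a - (- b) - b     ≈⟨ CR.+-congʳ (CR.+-congˡ (⁻¹-involutive b)) ⟩
        a + b - b         ≈⟨ CR.+-assoc a b (- b) ⟩
        a + (b - b)       ≈⟨ CR.+-congˡ (CR.-‿inverseʳ b) ⟩
        a + 0#            ≈⟨ CR.+-identityʳ a ⟩
        a                 ∎

    start end : Copy → ℂ
    start C = head v⁻ (thirdOf (H₁ C))
    end   C = head v⁻ (thirdOf (H₅ C))

    next : Markings
    next = record { v⁻ = v ; v = end C₀ -ᶜ start C₀ ; t = start C₀ -ᶜ tail C₀ }
      where
      C₀ : Copy
      C₀ = copy 1ᶜ 0ᶜ

  V₁ V₂ T₂ : ℂ
  V₁ = fromℕ 1 +i fromℕ 3 * √3
  V₂ = fromℕ 3 +i fromℕ 7 * √3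
  T₂ = fromℕ 2 +i - (fromℕ 2 * √3)

  -- The data of generations k+1 and k+2.
  markings : ℕ → Markings
  markings zero      = record { v⁻ = V₁ ; v = V₂ ; t = T₂ }
  markings (ℕ.suc k) = Composition.next (markings k)

  V : ℕ → ℂ
  V zero      = real (fromℕ 3) *ᶜ V₁ -ᶜ V₂
  V (ℕ.suc k) = Markings.v⁻ (markings k)

  -- Used for n ≥ 1 only, where the truncated subtraction is exact.
  G : ℕ → Carrier
  G n = fromℕ (8 ℕ.* lucas (4 ℕ.* n ℕ.∸ 2) ℕ.+ 21) ÷ 15

{-# OPTIONS --safe #-}
module Submission where

open import Defs
open import Algebra.Bundles using (CommutativeRing)
import Algebra.Properties.AbelianGroup as AbelianGroupProperties
import Algebra.Properties.Group as GroupProperties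
import Algebra.Properties.Ring as RingProperties
import Algebra.Properties.Semiring.Mult as NaturalMultiples
import Algebra.Properties.Semiring.Mult.TCOptimised as OptimisedMultiples
import Algebra.Solver.Ring as RingSolver
open import Algebra.Solver.Ring.AlmostCommutativeRing using (fromCommutativeRing; _-Raw-AlmostCommutative⟶_)
open import Data.Empty using (⊥-elim)
open import Data.Integer as ℤ using (ℤ; +_; -[1+_]; _⊖_)
import Data.Integer.Properties as ℤ
open import Data.Maybe.Base using (Maybe; just; nothing)
open import Data.Nat as ℕ using (ℕ; zero; suc)
import Data.Nat.Properties as ℕ
open import Data.Nat.Tactic.RingSolver using (solve-∀)
open import Data.Product using (_×_; _,_; proj₁; proj₂; ∃-syntax)
open import Data.Sum using (inj₁; inj₂)
open import Relation.Binary.PropositionalEquality as ≡ using (_≡_)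
import Relation.Binary.Reasoning.Setoid as SetoidReasoning
open import Relation.Nullary.Decidable using (yes; no)

-- Eliminating the tail offset by a linear relation that composition preserves turns the
-- construction into V (n+2) = 3 V (n+1) - V n, the recurrence of (F (2n), √3 L (2n)).
-- With F = F (2k), L = L (2k), F₂ = F (2k+2), L₂ = L (2k+2) one has L F₂ - F L₂ = 2 and
-- F F₂ + 3 L L₂ = 6 G (k+1), so the product of V (k+1) with the conjugate of V k is
-- 6 G (k+1) - 2√3 i, whose clockwise angle has cotangent G (k+1) √3.

module IntegerCoefficients {c ℓ} (R : CommutativeRing c ℓ) where
  open CommutativeRing R
  open OptimisedMultiples semiring using (×-homo-+; ×1-homo-*; 1+×) renaming (_×_ to _⊗_)
  open RingProperties ring using (-‿distribˡ-*; -‿distribʳ-*; -0#≈0#)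
  open GroupProperties +-group using (⁻¹-involutive; \\-leftDividesˡ)
  open AbelianGroupProperties +-abelianGroup using (⁻¹-∙-comm)
  open SetoidReasoning setoid

  fromℤ : ℤ → Carrier
  fromℤ (+ n)    = n ⊗ 1#
  fromℤ -[1+ n ] = - (suc n ⊗ 1#)

  fromℤ-neg : ∀ i → fromℤ (ℤ.- i) ≈ - fromℤ i
  fromℤ-neg (+ zero)  = sym -0#≈0#
  fromℤ-neg (+ suc n) = refl
  fromℤ-neg -[1+ n ]  = sym (⁻¹-involutive _)

  cancel-common : ∀ a x y → (a + x) - (a + y) ≈ x - y
  cancel-common a x y = begin
    (a + x) - (a + y)      ≈⟨ +-cong (+-comm a x) (sym (⁻¹-∙-comm a y)) ⟩
    (x + a) + (- a + - y)  ≈⟨ +-assoc x a _ ⟩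
    x + (a + (- a + - y))  ≈⟨ +-congˡ (\\-leftDividesˡ a (- y)) ⟩
    x - y                  ∎

  fromℤ-⊖ : ∀ m n → fromℤ (m ⊖ n) ≈ m ⊗ 1# - n ⊗ 1#
  fromℤ-⊖ m       zero    = sym (trans (+-congˡ -0#≈0#) (+-identityʳ _))
  fromℤ-⊖ zero    (suc n) = sym (+-identityˡ _)
  fromℤ-⊖ (suc m) (suc n) = begin
    fromℤ (suc m ⊖ suc n)          ≡⟨ ≡.cong fromℤ (ℤ.[1+m]⊖[1+n]≡m⊖n m n) ⟩
    fromℤ (m ⊖ n)                  ≈⟨ fromℤ-⊖ m n ⟩
    m ⊗ 1# - n ⊗ 1#                ≈⟨ cancel-common 1# _ _ ⟨
    (1# + m ⊗ 1#) - (1# + n ⊗ 1#)  ≈⟨ +-cong (1+× m 1#) (-‿cong (1+× n 1#)) ⟨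
    suc m ⊗ 1# - suc n ⊗ 1#        ∎

  fromℤ-+ : ∀ i j → fromℤ (i ℤ.+ j) ≈ fromℤ i + fromℤ j
  fromℤ-+ (+ m)    (+ n)    = ×-homo-+ 1# m n
  fromℤ-+ (+ m)    -[1+ n ] = fromℤ-⊖ m (suc n)
  fromℤ-+ -[1+ m ] (+ n)    = trans (fromℤ-⊖ n (suc m)) (+-comm _ _)
  fromℤ-+ -[1+ m ] -[1+ n ] = begin
    - (suc (suc (m ℕ.+ n)) ⊗ 1#)     ≡⟨ ≡.cong (λ k → - (suc k ⊗ 1#)) (ℕ.+-suc m n) ⟨
    - ((suc m ℕ.+ suc n) ⊗ 1#)       ≈⟨ -‿cong (×-homo-+ 1# (suc m) (suc n)) ⟩
    - (suc m ⊗ 1# + suc n ⊗ 1#)      ≈⟨ ⁻¹-∙-comm _ _ ⟨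
    - (suc m ⊗ 1#) - (suc n ⊗ 1#)    ∎

  fromℤ-+* : ∀ m j → fromℤ (+ m ℤ.* j) ≈ m ⊗ 1# * fromℤ j
  fromℤ-+* m (+ n) = begin
    fromℤ (+ m ℤ.* + n)    ≡⟨ ≡.cong fromℤ (ℤ.pos-* m n) ⟨
    (m ℕ.* n) ⊗ 1#         ≈⟨ ×1-homo-* m n ⟩
    m ⊗ 1# * n ⊗ 1#        ∎
  fromℤ-+* m -[1+ n ] = begin
    fromℤ (+ m ℤ.* -[1+ n ])           ≡⟨ ≡.cong fromℤ (ℤ.neg-distribʳ-* (+ m) (+ suc n)) ⟨
    fromℤ (ℤ.- (+ m ℤ.* + suc n))      ≈⟨ fromℤ-neg (+ m ℤ.* + suc n) ⟩
    - fromℤ (+ m ℤ.* + suc n)          ≈⟨ -‿cong (fromℤ-+* m (+ suc n)) ⟩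
    - (m ⊗ 1# * suc n ⊗ 1#)            ≈⟨ -‿distribʳ-* _ _ ⟩
    m ⊗ 1# * - (suc n ⊗ 1#)            ∎

  fromℤ-* : ∀ i j → fromℤ (i ℤ.* j) ≈ fromℤ i * fromℤ j
  fromℤ-* (+ m)    j = fromℤ-+* m j
  fromℤ-* -[1+ m ] j = begin
    fromℤ (-[1+ m ] ℤ.* j)             ≡⟨ ≡.cong fromℤ (ℤ.neg-distribˡ-* (+ suc m) j) ⟨
    fromℤ (ℤ.- (+ suc m ℤ.* j))        ≈⟨ fromℤ-neg (+ suc m ℤ.* j) ⟩
    - fromℤ (+ suc m ℤ.* j)            ≈⟨ -‿cong (fromℤ-+* (suc m) j) ⟩
    - (suc m ⊗ 1# * fromℤ j)           ≈⟨ -‿distribˡ-* _ _ ⟩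
    - (suc m ⊗ 1#) * fromℤ j           ∎

  morphism : ℤ.+-*-rawRing -Raw-AlmostCommutative⟶ fromCommutativeRing R
  morphism = record
    { ⟦_⟧    = fromℤ
    ; +-homo = fromℤ-+
    ; *-homo = fromℤ-*
    ; -‿homo = fromℤ-neg
    ; 0-homo = refl
    ; 1-homo = refl
    }

  _≟_ : ∀ i j → Maybe (fromℤ i ≈ fromℤ j)
  i ≟ j with i ℤ.≟ j
  ... | yes i≡j = just (reflexive (≡.cong fromℤ i≡j))
  ... | no  _   = nothing

  open RingSolver ℤ.+-*-rawRing (fromCommutativeRing R) morphism _≟_ public
    using (Polynomial; con; _:+_; _:*_; _:-_; :-_; _:×_; _:=_)
    renaming (solve to ring)

  -- With these constants, k :× :1 denotes fromℕ k definitionally.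
  :0 :1 : ∀ {n} → Polynomial n
  :0 = con (+ 0)
  :1 = con (+ 1)

  -- Equality modulo the ideal generated by a - b: the premise is l - r ≈ q * (a - b).
  modulo : ∀ {a b} → a ≈ b → ∀ q {l r} → l + q * b ≈ r + q * a → l ≈ r
  modulo {a} {b} a≈b q {l} {r} eq = +-cancelʳ (q * a) l r (trans (+-congˡ (*-congˡ a≈b)) eq)
    where open GroupProperties +-group using () renaming (∙-cancelʳ to +-cancelʳ)

module FibonacciLucas where
  open import Data.Nat using (_+_; _*_)

  moduloℕ : ∀ {a b} → a ≡ b → ∀ q {l r} → l + q * b ≡ r + q * a → l ≡ r
  moduloℕ ≡.refl q eq = ℕ.+-cancelʳ-≡ _ _ _ eq

  private
    four-steps : ∀ x y → ((y + x) + y) + (y + x) + x ≡ (y + x) + (y + x) + (y + x)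
    four-steps = solve-∀

  fib-recurrence : ∀ m → fib (4 + m) + fib m ≡ fib (2 + m) + fib (2 + m) + fib (2 + m)
  fib-recurrence m = four-steps (fib m) (fib (1 + m))

  lucas-recurrence : ∀ m → lucas (4 + m) + lucas m ≡ lucas (2 + m) + lucas (2 + m) + lucas (2 + m)
  lucas-recurrence m = four-steps (lucas m) (lucas (1 + m))

  lucas+fib : ∀ m → lucas m + fib m ≡ 2 * fib (1 + m)
  lucas+fib 0 = ≡.refl
  lucas+fib 1 = ≡.refl
  lucas+fib (suc (suc m)) = moduloℕ (lucas+fib (suc m)) 1 (moduloℕ (lucas+fib m) 1
    (lemma (lucas m) (lucas (suc m)) (fib m) (fib (suc m))))
    where
    lemma : ∀ l l′ f f′ →
      (((l′ + l) + (f′ + f)) + 1 * (2 * (f′ + f))) + 1 * (2 * f′)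
      ≡ (2 * ((f′ + f) + f′) + 1 * (l′ + f′)) + 1 * (l + f)
    lemma = solve-∀

  lucas-suc : ∀ m → lucas (1 + m) ≡ 2 * fib m + fib (1 + m)
  lucas-suc 0 = ≡.refl
  lucas-suc 1 = ≡.refl
  lucas-suc (suc (suc m)) = ≡.trans (≡.cong₂ _+_ (lucas-suc (suc m)) (lucas-suc m)) (lemma (fib m) (fib (suc m)))
    where
    lemma : ∀ f f′ → (2 * f′ + (f′ + f)) + (2 * f + f′) ≡ 2 * (f′ + f) + ((f′ + f) + f′)
    lemma = solve-∀

  even-induction : ∀ {p} (P : ℕ → Set p) → P 0 → (∀ m → P m → P (2 + m)) → ∀ k → P (2 * k)
  even-induction P base step zero    = base
  even-induction P base step (suc k) =
    ≡.subst P (≡.sym (ℕ.*-suc 2 k)) (step (2 * k) (even-induction P base step k))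

  lucas*fib-even : ∀ k → let m = 2 * k in lucas m * fib (1 + m) ≡ fib m * lucas (1 + m) + 2
  lucas*fib-even = even-induction (λ m → lucas m * fib (1 + m) ≡ fib m * lucas (1 + m) + 2) ≡.refl
    λ m eq → moduloℕ eq 1 (lemma (lucas m) (lucas (1 + m)) (fib m) (fib (1 + m)))
    where
    lemma : ∀ l l′ f f′ →
      (l′ + l) * ((f′ + f) + f′) + 1 * (f * l′ + 2)
      ≡ ((f′ + f) * ((l′ + l) + l′) + 2) + 1 * (l * f′)
    lemma = solve-∀

  LucasQuadratic : ℕ → ℕ → Set
  LucasQuadratic m n =
    lucas (2 + n) ≡ 2 * a * a + 2 * a * b + 3 * b * b ×
    lucas (3 + n) ≡ a * a + 6 * a * b + 4 * b * b
    where
    a = fib m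
    b = fib (1 + m)

  lucas-quadratic : ∀ k → LucasQuadratic (2 * k) (4 * k)
  lucas-quadratic zero = ≡.refl , ≡.refl
  lucas-quadratic (suc k) =
    ≡.subst₂ LucasQuadratic (≡.sym (ℕ.*-suc 2 k)) (≡.sym (ℕ.*-suc 4 k)) (step (2 * k) (4 * k) (lucas-quadratic k))
    where
    lemma₂ : ∀ a b →
      let x = 2 * a * a + 2 * a * b + 3 * b * b
          y = a * a + 6 * a * b + 4 * b * b
          a′ = b + a
          b′ = (b + a) + b
      in ((y + x) + y) + (y + x) ≡ 2 * a′ * a′ + 2 * a′ * b′ + 3 * b′ * b′
    lemma₂ = solve-∀
    lemma₃ : ∀ a b →
      let x = 2 * a * a + 2 * a * b + 3 * b * b
          y = a * a + 6 * a * b + 4 * b * b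
          a′ = b + a
          b′ = (b + a) + b
      in (((y + x) + y) + (y + x)) + ((y + x) + y) ≡ a′ * a′ + 6 * a′ * b′ + 4 * b′ * b′
    lemma₃ = solve-∀
    step : ∀ m n → LucasQuadratic m n → LucasQuadratic (2 + m) (4 + n)
    step m n (eq₂ , eq₃) rewrite eq₃ | eq₂ = lemma₂ (fib m) (fib (1 + m)) , lemma₃ (fib m) (fib (1 + m))

  fib*lucas-even : ∀ k → let m = 2 * k in lucas m * fib (2 + m) ≡ fib m * lucas (2 + m) + 2
  fib*lucas-even k = moduloℕ (lucas*fib-even k) 1 (lemma (lucas m) (lucas (1 + m)) (fib m) (fib (1 + m)))
    where
    m = 2 * k
    lemma : ∀ l l′ f f′ →
      l * (f′ + f) + 1 * (f * l′ + 2) ≡ (f * (l′ + l) + 2) + 1 * (l * f′)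
    lemma = solve-∀

  lucas-4k+2 : ∀ k → let m = 2 * k in
    2 * (8 * lucas (2 + 4 * k) + 21) ≡ 5 * (fib m * fib (2 + m) + 3 * (lucas m * lucas (2 + m)))
  lucas-4k+2 k =
    moduloℕ (proj₁ (lucas-quadratic k)) 16
    (moduloℕ (≡.sym (lucas*fib-even k)) 21
    (moduloℕ (≡.sym (lucas-suc m)) (15 * l + 21 * a)
    (moduloℕ (≡.sym (lucas+fib m)) (15 * (l + a) + 24 * b)
    (lemma (lucas (2 + 4 * k)) l l′ a b))))
    where
    m = 2 * k
    l = lucas m
    l′ = lucas (1 + m)
    a = fib m
    b = fib (1 + m)
    lemma : ∀ Q l l′ a b →
      (((2 * (8 * Q + 21)
        + 16 * (2 * a * a + 2 * a * b + 3 * b * b))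
        + 21 * (l * b))
        + (15 * l + 21 * a) * l′)
        + (15 * (l + a) + 24 * b) * (l + a)
      ≡ (((5 * (a * (b + a) + 3 * (l * (l′ + l)))
        + 16 * Q)
        + 21 * (a * l′ + 2))
        + (15 * l + 21 * a) * (2 * a + b))
        + (15 * (l + a) + 24 * b) * (2 * b)
    lemma = solve-∀

  lucas-positive : ∀ n → 0 ℕ.< lucas n
  lucas-positive 0 = ℕ.z<s
  lucas-positive 1 = ℕ.z<s
  lucas-positive (suc (suc n)) = ℕ.<-≤-trans (lucas-positive (suc n)) (ℕ.m≤m+n _ _)

module OrderedFieldProperties {c ℓ₁ ℓ₂} (F : OrderedField c ℓ₁ ℓ₂) where
  open OrderedField F
  open CR using (refl; sym; trans; +-identityˡ; -‿inverseʳ)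
  open IntegerCoefficients commutativeRing
  open NaturalMultiples CR.semiring using (×-homo-+; ×1-homo-*)

  fromℕ-+ : ∀ m n → fromℕ (m ℕ.+ n) ≈ fromℕ m + fromℕ n
  fromℕ-+ = ×-homo-+ 1#

  fromℕ-* : ∀ m n → fromℕ (m ℕ.* n) ≈ fromℕ m * fromℕ n
  fromℕ-* = ×1-homo-*

  fromℕ-cong : ∀ {m n} → m ≡ n → fromℕ m ≈ fromℕ n
  fromℕ-cong eq = CR.reflexive (≡.cong fromℕ eq)

  fromℕ-positive : ∀ {n} → 0 ℕ.< n → 0# < fromℕ n
  fromℕ-positive {suc n} _ = 0<fromℕ-suc n

  <-resp-≈ : ∀ {x x′ y y′} → x ≈ x′ → y ≈ y′ → x < y → x′ < y′
  <-resp-≈ x≈x′ y≈y′ x<y = SPO.<-respʳ-≈ y≈y′ (SPO.<-respˡ-≈ x≈x′ x<y)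

  <⇒≤ : ∀ {x y} → x < y → x ≤ y
  <⇒≤ x<y y<x = SPO.irrefl refl (SPO.trans x<y y<x)

  x<0⇒0<-x : ∀ {x} → x < 0# → 0# < - x
  x<0⇒0<-x {x} x<0 = <-resp-≈ (-‿inverseʳ x) (+-identityˡ _) (+-monoˡ-< (- x) x<0)

  0<y-x⇒x<y : ∀ {x y} → 0# < y - x → x < y
  0<y-x⇒x<y {x} {y} 0<y-x =
    <-resp-≈ (+-identityˡ x) (ring 2 (λ x y → (y :- x) :+ x := y) refl x y) (+-monoˡ-< x 0<y-x)

  x<y+x : ∀ {x y} → 0# < y → x < y + x
  x<y+x {x} 0<y = SPO.<-respˡ-≈ (+-identityˡ x) (+-monoˡ-< x 0<y)

  +-positive : ∀ {x y} → 0# < x → 0# < y → 0# < x + y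
  +-positive 0<x 0<y = SPO.trans 0<y (x<y+x 0<x)

  inverse : ∀ {x} → 0# < x → ∃[ i ] (0# < i × x * i ≈ 1#)
  inverse {x} 0<x with HF.#⇒invertible {x} {0#} (inj₂ 0<x)
  ... | i , _ , xi = i , 0<i , x*i≈1
    where
    x*i≈1 : x * i ≈ 1#
    x*i≈1 = trans (ring 2 (λ x i → x :* i := (x :- :0) :* i) refl x i) xi
    i≉0 : i # 0#
    i≉0 = HF.invertible⇒# (x , trans (ring 2 (λ x i → x :* (i :- :0) := x :* i) refl x i) x*i≈1
                             , trans (ring 2 (λ x i → (i :- :0) :* x := x :* i) refl x i) x*i≈1)
    0<i : 0# < i
    0<i with i≉0
    ... | inj₂ 0<i = 0<i
    ... | inj₁ i<0 = ⊥-elim (SPO.irrefl refl (SPO.trans 0<1 1<0))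
      where
      0<-1 : 0# < - 1#
      0<-1 = SPO.<-respʳ-≈
        (modulo (sym x*i≈1) 1# (ring 2 (λ x i → x :* (:- i) :+ :1 :* (x :* i) := :- :1 :+ :1 :* :1) refl x i))
        (*-positive 0<x (x<0⇒0<-x i<0))
      1<0 : 1# < 0#
      1<0 = <-resp-≈ (+-identityˡ 1#) (CR.-‿inverseˡ 1#) (+-monoˡ-< 1# 0<-1)

  *-cancelˡ-positive : ∀ {x y z} → 0# < x → x * y ≈ x * z → y ≈ z
  *-cancelˡ-positive {x} {y} {z} 0<x xy≈xz with inverse 0<x
  ... | i , _ , xi≈1 = modulo (sym xi≈1) (y - z) (modulo xy≈xz i
    (ring 4 (λ x y z i → (y :+ (y :- z) :* (x :* i)) :+ i :* (x :* z) := (z :+ (y :- z) :* :1) :+ i :* (x :* y)) refl x y z i))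

  positive-factorʳ : ∀ {x y} → 0# < x → 0# < x * y → 0# < y
  positive-factorʳ {x} {y} 0<x 0<xy with inverse 0<x
  ... | i , 0<i , xi≈1 = SPO.<-respʳ-≈
    (modulo xi≈1 y (ring 3 (λ x y i → i :* (x :* y) :+ y :* :1 := y :+ y :* (x :* i)) refl x y i))
    (*-positive 0<i 0<xy)

  ÷-cancel : ∀ n x → fromℕ (suc n) * (x ÷ suc n) ≈ x
  ÷-cancel n x = modulo xi≈1 x (ring 3 (λ m x i → m :* (x :* i) :+ x :* :1 := x :+ x :* (m :* i)) refl m x i)
    where
    m = fromℕ (suc n)
    i = 1/ (suc n)
    xi≈1 : m * i ≈ 1#
    xi≈1 = trans (ring 2 (λ x i → x :* i := (x :- :0) :* i) refl m i)
      (proj₂ (proj₂ (HF.#⇒invertible {m} {0#} (inj₂ (0<fromℕ-suc n)))))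

module Trigonometry {c ℓ₁ ℓ₂} (ℝ : RealNumbers c ℓ₁ ℓ₂) where
  open RealNumbers ℝ
  open Supertiles ℝ using (√3)
  open OrderedFieldProperties orderedField
  open IntegerCoefficients commutativeRing
  open CR using (refl; sym; trans; +-cong; *-congʳ)

  sin-positive : ∀ {x} → 0# < x → x < π ÷ 2 → 0# < sin x
  sin-positive 0<x x<π/2 = SPO.trans (*-positive 0<x (cos-positive 0<x x<π/2)) (sin-lower 0<x x<π/2)

  module _ (x : Carrier) where
    private
      C  = cos x
      S  = sin x
      C′ = cos (- x)
      S′ = sin (- x)

      cos-x+-x : C * C′ - S * S′ ≈ 1#
      cos-x+-x = trans (sym (cos-+ x (- x))) (trans (cos-cong (CR.-‿inverseʳ x)) cos-0)

      sin-x+-x : S * C′ + C * S′ ≈ 0#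
      sin-x+-x = trans (sym (sin-+ x (- x))) (trans (sin-cong (CR.-‿inverseʳ x)) sin-0)

    cos-neg : cos (- x) ≈ cos x
    cos-neg = modulo (sym (cos²+sin² x)) C′ (modulo cos-x+-x C (modulo sin-x+-x S
      (ring 4 (λ C S C′ S′ →
         ((C′ :+ C′ :* (C :* C :+ S :* S)) :+ C :* :1) :+ S :* :0
      := ((C :+ C′ :* :1) :+ C :* (C :* C′ :- S :* S′)) :+ S :* (S :* C′ :+ C :* S′)) refl C S C′ S′)))

    sin-neg : sin (- x) ≈ - sin x
    sin-neg = modulo (sym (cos²+sin² x)) S′ (modulo (sym cos-x+-x) S (modulo sin-x+-x C
      (ring 4 (λ C S C′ S′ →
         ((S′ :+ S′ :* (C :* C :+ S :* S)) :+ S :* (C :* C′ :- S :* S′)) :+ C :* :0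
      := ((:- S :+ S′ :* :1) :+ S :* :1) :+ C :* (S :* C′ :+ C :* S′)) refl C S C′ S′)))

  π/2+π/2≈π : π ÷ 2 + π ÷ 2 ≈ π
  π/2+π/2≈π = trans (ring 1 (λ b → b :+ b := (2 :× :1) :* b) refl (π ÷ 2)) (÷-cancel 1 π)

  0<π/2 : 0# < π ÷ 2
  0<π/2 = positive-factorʳ (0<fromℕ-suc 1) (SPO.<-respʳ-≈ (sym (÷-cancel 1 π)) 0<π)

  0<π/3 : 0# < π ÷ 3
  0<π/3 = positive-factorʳ (0<fromℕ-suc 2) (SPO.<-respʳ-≈ (sym (÷-cancel 2 π)) 0<π)

  π/3<π/2 : π ÷ 3 < π ÷ 2
  π/3<π/2 = 0<y-x⇒x<y (positive-factorʳ (0<fromℕ-suc 5) (SPO.<-respʳ-≈ eq 0<π))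
    where
    eq : π ≈ fromℕ 6 * (π ÷ 2 - π ÷ 3)
    eq = modulo (÷-cancel 1 π) (- fromℕ 3) (modulo (÷-cancel 2 π) (fromℕ 2)
      (ring 3 (λ p b a →
         (p :+ (:- (3 :× :1)) :* p) :+ (2 :× :1) :* p
      := ((6 :× :1) :* (b :- a) :+ (:- (3 :× :1)) :* ((2 :× :1) :* b)) :+ (2 :× :1) :* ((3 :× :1) :* a))
      refl π (π ÷ 2) (π ÷ 3)))

  x<π/2⇒x<2π : ∀ {x} → x < π ÷ 2 → x < fromℕ 2 * π
  x<π/2⇒x<2π x<π/2 = SPO.trans x<π/2 (SPO.<-respʳ-≈
    (modulo π/2+π/2≈π (fromℕ 2)
      (ring 2 (λ b p → ((b :+ b :+ b) :+ b) :+ (2 :× :1) :* p := (2 :× :1) :* p :+ (2 :× :1) :* (b :+ b)) refl (π ÷ 2) π))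
    (x<y+x (+-positive (+-positive 0<π/2 0<π/2) 0<π/2)))

  private
    a = π ÷ 3
    C = cos a
    S = sin a
    s = √3

  0<√3 : 0# < √3
  0<√3 = √-positive (0<fromℕ-suc 2)

  √3² : √3 * √3 ≈ fromℕ 3
  √3² = √-square (0<fromℕ-suc 2)

  private
    0<C = cos-positive 0<π/3 π/3<π/2
    0<S = sin-positive 0<π/3 π/3<π/2

    sin-π : sin (a + a + a) ≈ 0#
    sin-π = trans (sin-cong 3a≈2b) (trans (sin-+ b b) (modulo cos-π/2 (fromℕ 2 * sin b)
      (ring 2 (λ C S → (S :* C :+ C :* S) :+ ((2 :× :1) :* S) :* :0 := :0 :+ ((2 :× :1) :* S) :* C)
        refl (cos b) (sin b))))
      where
      b = π ÷ 2
      3a≈2b : a + a + a ≈ b + b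
      3a≈2b = trans (ring 1 (λ a → a :+ a :+ a := (3 :× :1) :* a) refl a) (trans (÷-cancel 2 π) (sym π/2+π/2≈π))

    -- For 0 < a < π/2 the first factor is positive, so that sin 3a = 0 forces 2 cos a = 1.
    sin-3a : sin (a + a + a) ≈ (S * (1# + (C + C))) * (C + C - 1#)
    sin-3a = trans (sin-+ (a + a) a) (trans (+-cong (*-congʳ (sin-+ a a)) (*-congʳ (cos-+ a a)))
      (modulo (cos²+sin² a) (- S) (ring 2 (λ C S →
         ((S :* C :+ C :* S) :* C :+ (C :* C :- S :* S) :* S) :+ (:- S) :* :1
      := (S :* (:1 :+ (C :+ C))) :* (C :+ C :- :1) :+ (:- S) :* (C :* C :+ S :* S)) refl C S)))

  2cos-π/3 : cos (π ÷ 3) + cos (π ÷ 3) ≈ 1#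
  2cos-π/3 = modulo
    (*-cancelˡ-positive (*-positive 0<S (+-positive 0<1 (+-positive 0<C 0<C)))
      (trans (sym sin-3a) (trans sin-π (sym (CR.zeroʳ _)))))
    1# (ring 1 (λ C → (C :+ C) :+ :1 :* :0 := :1 :+ :1 :* (C :+ C :- :1)) refl C)

  2sin-π/3 : sin (π ÷ 3) + sin (π ÷ 3) ≈ √3
  2sin-π/3 = *-cancelˡ-positive (+-positive 0<√3 (+-positive 0<S 0<S))
    (modulo (cos²+sin² a) (fromℕ 4) (modulo 2cos-π/3 (- (C + C + 1#)) (modulo (sym √3²) 1#
      (ring 3 (λ C S s →
         (((s :+ (S :+ S)) :* (S :+ S) :+ (4 :× :1) :* :1) :+ (:- (C :+ C :+ :1)) :* :1) :+ :1 :* (s :* s)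
      := (((s :+ (S :+ S)) :* s :+ (4 :× :1) :* (C :* C :+ S :* S)) :+ (:- (C :+ C :+ :1)) :* (C :+ C)) :+ :1 :* (3 :× :1))
      refl C S s))))

module ComplexRing {c ℓ₁ ℓ₂} (ℝ : RealNumbers c ℓ₁ ℓ₂) where
  open RealNumbers ℝ
  open Plane ℝ
  open CR using (refl; sym; trans; +-cong; *-cong; -‿cong)
  open IntegerCoefficients commutativeRing

  -ᶜ_ : ℂ → ℂ
  -ᶜ z = (- re z) +i (- im z)

  complexRing : CommutativeRing c ℓ₁
  complexRing = record
    { Carrier = ℂ
    ; _≈_ = _≈ᶜ_
    ; _+_ = _+ᶜ_
    ; _*_ = _*ᶜ_
    ; -_ = -ᶜ_
    ; 0# = 0ᶜ
    ; 1# = 1ᶜ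
    ; isCommutativeRing = record
      { isRing = record
        { +-isAbelianGroup = record
          { isGroup = record
            { isMonoid = record
              { isSemigroup = record
                { isMagma = record
                  { isEquivalence = record
                    { refl = refl , refl
                    ; sym = λ (p , q) → sym p , sym q
                    ; trans = λ (p , q) (r , t) → trans p r , trans q t
                    }
                  ; ∙-cong = λ (p , q) (r , t) → +-cong p r , +-cong q t
                  }
                ; assoc = λ x y z → CR.+-assoc _ _ _ , CR.+-assoc _ _ _
                }
              ; identity = (λ x → CR.+-identityˡ _ , CR.+-identityˡ _) , (λ x → CR.+-identityʳ _ , CR.+-identityʳ _)
              }
            ; inverse = (λ x → CR.-‿inverseˡ _ , CR.-‿inverseˡ _) , (λ x → CR.-‿inverseʳ _ , CR.-‿inverseʳ _)
            ; ⁻¹-cong = λ (p , q) → -‿cong p , -‿cong q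
            }
          ; comm = λ x y → CR.+-comm _ _ , CR.+-comm _ _
          }
        ; *-cong = λ (p , q) (r , t) → +-cong (*-cong p r) (-‿cong (*-cong q t)) , +-cong (*-cong p t) (*-cong q r)
        ; *-assoc = λ (a +i b) (c +i d) (e +i f) →
            ring 6 (λ a b c d e f → (a :* c :- b :* d) :* e :- (a :* d :+ b :* c) :* f
                                 := a :* (c :* e :- d :* f) :- b :* (c :* f :+ d :* e)) refl a b c d e f
          , ring 6 (λ a b c d e f → (a :* c :- b :* d) :* f :+ (a :* d :+ b :* c) :* e
                                 := a :* (c :* f :+ d :* e) :+ b :* (c :* e :- d :* f)) refl a b c d e f
        ; *-identity =
            (λ (a +i b) → ring 2 (λ a b → :1 :* a :- :0 :* b := a) refl a b
                        , ring 2 (λ a b → :1 :* b :+ :0 :* a := b) refl a b)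
          , (λ (a +i b) → ring 2 (λ a b → a :* :1 :- b :* :0 := a) refl a b
                        , ring 2 (λ a b → a :* :0 :+ b :* :1 := b) refl a b)
        ; distrib =
            (λ (a +i b) (c +i d) (e +i f) →
              ring 6 (λ a b c d e f → a :* (c :+ e) :- b :* (d :+ f)
                                   := (a :* c :- b :* d) :+ (a :* e :- b :* f)) refl a b c d e f
            , ring 6 (λ a b c d e f → a :* (d :+ f) :+ b :* (c :+ e)
                                   := (a :* d :+ b :* c) :+ (a :* f :+ b :* e)) refl a b c d e f)
          , (λ (a +i b) (c +i d) (e +i f) →
              ring 6 (λ a b c d e f → (c :+ e) :* a :- (d :+ f) :* b
                                   := (c :* a :- d :* b) :+ (e :* a :- f :* b)) refl a b c d e f
            , ring 6 (λ a b c d e f → (c :+ e) :* b :+ (d :+ f) :* a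
                                   := (c :* b :+ d :* a) :+ (e :* b :+ f :* a)) refl a b c d e f)
        }
      ; *-comm = λ (a +i b) (c +i d) →
            ring 4 (λ a b c d → a :* c :- b :* d := c :* a :- d :* b) refl a b c d
          , ring 4 (λ a b c d → a :* d :+ b :* c := c :* b :+ d :* a) refl a b c d
      }
    }

module Recurrence {c ℓ₁ ℓ₂} (ℝ : RealNumbers c ℓ₁ ℓ₂) where
  open RealNumbers ℝ
  open Plane ℝ
  open Supertiles ℝ
  open Trigonometry ℝ
  open ComplexRing ℝ
  open CR using (refl; sym; trans; +-cong; +-congˡ)

  private
    module R = IntegerCoefficients commutativeRing
    module C = IntegerCoefficients complexRing

    2re-ω⁻¹ : re ω⁻¹ + re ω⁻¹ ≈ 1#
    2re-ω⁻¹ = trans (+-cong (cos-neg _) (cos-neg _)) 2cos-π/3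

  ω+ω⁻¹ : ω +ᶜ ω⁻¹ ≈ᶜ 1ᶜ
  ω+ω⁻¹ = trans (+-congˡ (cos-neg _)) 2cos-π/3 , trans (+-congˡ (sin-neg _)) (CR.-‿inverseʳ _)

  ω⁻¹-square : ω⁻¹ *ᶜ ω⁻¹ +ᶜ 1ᶜ ≈ᶜ ω⁻¹
  ω⁻¹-square =
      R.modulo 2re-ω⁻¹ (re ω⁻¹) (R.modulo (cos²+sin² _) (- 1#) (R.ring 2 (λ c h →
           (((c :* c :- h :* h) :+ :1) :+ c :* :1) :+ (:- :1) :* :1
        := (c :+ c :* (c :+ c)) :+ (:- :1) :* (c :* c :+ h :* h)) refl (re ω⁻¹) (im ω⁻¹)))
    , R.modulo 2re-ω⁻¹ (im ω⁻¹) (R.ring 2 (λ c h →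
           ((c :* h :+ h :* c) :+ :0) :+ h :* :1
        := h :+ h :* (c :+ c)) refl (re ω⁻¹) (im ω⁻¹))
    where open R

  -- Holds for V₁, V₂, T₂ and is preserved by next; it eliminates t from the recurrence for v.
  TailRelation : Markings → Set ℓ₁
  TailRelation M = t ≈ᶜ (ω⁻¹ +ᶜ ω⁻¹ -ᶜ ω) *ᶜ v⁻ -ᶜ ω⁻¹ *ᶜ v
    where open Markings M

  -- The terms tail (thirdOf X), start C₀ and end C₀ of Composition as polynomials in ω, ω⁻¹, v⁻, v, t;
  -- they follow those definitions symbol by symbol, so that they denote them definitionally.
  module _ {k} (w z m v t : C.Polynomial k) where
    open C
    third-tail : (u p : Polynomial k) → Polynomial k
    third-tail u p = ((p :- u :* t) :+ (u :* (z :* z)) :* m) :+ (u :* z) :* m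

    start-poly end-poly : Polynomial k
    start-poly = third-tail (:1 :* (z :* z)) :0 :+ (:1 :* (z :* z)) :* m
    end-poly = third-tail (:1 :* w) ((third-tail :1 :0 :- (:0 :- :1 :* t)) :+ :1 :* v) :+ (:1 :* w) :* m

  module _ (M : Markings) (rel : TailRelation M) where
    open Markings M
    open Markings (Composition.next M) using () renaming (v to v′; t to t′)
    open C

    supervector-recurrence : v′ +ᶜ v⁻ ≈ᶜ v +ᶜ v +ᶜ v
    supervector-recurrence = C.modulo rel (ω⁻¹ *ᶜ ω⁻¹ -ᶜ ω)
      (C.modulo ω+ω⁻¹ ((ω -ᶜ (ω⁻¹ +ᶜ ω⁻¹) +ᶜ (1ᶜ +ᶜ 1ᶜ)) *ᶜ v⁻ +ᶜ ω⁻¹ *ᶜ v)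
        (C.modulo ω⁻¹-square ((1ᶜ +ᶜ 1ᶜ +ᶜ 1ᶜ -ᶜ ω⁻¹ *ᶜ ω⁻¹) *ᶜ v⁻ -ᶜ (ω⁻¹ +ᶜ (1ᶜ +ᶜ 1ᶜ)) *ᶜ v)
        (C.ring 5 (λ w z m v t →
            (((end-poly w z m v t :- start-poly w z m v t) :+ m
              :+ (z :* z :- w) :* ((z :+ z :- w) :* m :- z :* v))
              :+ ((w :- (z :+ z) :+ (:1 :+ :1)) :* m :+ z :* v) :* :1)
              :+ ((:1 :+ :1 :+ :1 :- z :* z) :* m :- (z :+ (:1 :+ :1)) :* v) :* z
         := ((v :+ v :+ v
              :+ (z :* z :- w) :* t)
              :+ ((w :- (z :+ z) :+ (:1 :+ :1)) :* m :+ z :* v) :* (w :+ z))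
              :+ ((:1 :+ :1 :+ :1 :- z :* z) :* m :- (z :+ (:1 :+ :1)) :* v) :* (z :* z :+ :1))
        (refl , refl) ω ω⁻¹ v⁻ v t)))

    TailRelation-next : TailRelation (Composition.next M)
    TailRelation-next = C.modulo rel (-ᶜ (ω⁻¹ *ᶜ ω⁻¹))
      (C.modulo supervector-recurrence ω⁻¹
      (C.modulo ω+ω⁻¹ (ω⁻¹ *ᶜ ω⁻¹ *ᶜ v⁻ +ᶜ v)
      (C.modulo ω⁻¹-square ((ω⁻¹ *ᶜ ω⁻¹ -ᶜ ω⁻¹) *ᶜ v⁻ +ᶜ (ω⁻¹ +ᶜ 1ᶜ) *ᶜ v)
      (C.ring 6 (λ w z m v t v′ →
           (((start-poly w z m v t :- :0
             :+ (:- (z :* z)) :* ((z :+ z :- w) :* m :- z :* v))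
             :+ z :* (v :+ v :+ v))
             :+ (z :* z :* m :+ v) :* :1)
             :+ ((z :* z :- z) :* m :+ (z :+ :1) :* v) :* z
        := ((((z :+ z :- w) :* v :- z :* v′
             :+ (:- (z :* z)) :* t)
             :+ z :* (v′ :+ m))
             :+ (z :* z :* m :+ v) :* (w :+ z))
             :+ ((z :* z :- z) :* m :+ (z :+ :1) :* v) :* (z :* z :+ :1))
        (refl , refl) ω ω⁻¹ v⁻ v t v′))))

  markings-TailRelation : ∀ k → TailRelation (markings k)
  markings-TailRelation (suc k) = TailRelation-next (markings k) (markings-TailRelation k)
  markings-TailRelation zero =
      R.modulo (proj₁ ω+ω⁻¹) 1# (R.modulo (proj₂ ω+ω⁻¹) (- √3)
      (R.modulo 2sin-π/3 (- √3) (R.modulo (sym √3²) 1#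
      (R.ring 5 (λ c h c′ h′ s →
           (((2 :× :1 :+ :1 :* :1) :+ (:- s) :* :0) :+ (:- s) :* s) :+ :1 :* (s :* s)
        := ((((((c′ :+ c′ :- c) :* (1 :× :1) :- (h′ :+ h′ :- h) :* ((3 :× :1) :* s))
              :- (c′ :* (3 :× :1) :- h′ :* ((7 :× :1) :* s)))
              :+ :1 :* (c :+ c′)) :+ (:- s) :* (h :+ h′)) :+ (:- s) :* (h :+ h)) :+ :1 :* (3 :× :1))
        refl (re ω) (im ω) (re ω⁻¹) (im ω⁻¹) √3))))
    , R.modulo (proj₁ ω+ω⁻¹) √3 (R.modulo (proj₂ ω+ω⁻¹) 1# (R.modulo 2cos-π/3 √3
      (R.ring 5 (λ c h c′ h′ s →
           (((:- ((2 :× :1) :* s)) :+ s :* :1) :+ :1 :* :0) :+ s :* :1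
        := (((((c′ :+ c′ :- c) :* ((3 :× :1) :* s) :+ (h′ :+ h′ :- h) :* (1 :× :1))
              :- (c′ :* ((7 :× :1) :* s) :+ h′ :* (3 :× :1)))
              :+ s :* (c :+ c′)) :+ :1 :* (h :+ h′)) :+ s :* (c :+ c))
        refl (re ω) (im ω) (re ω⁻¹) (im ω⁻¹) √3)))
    where open R

module ClosedForm {c ℓ₁ ℓ₂} (ℝ : RealNumbers c ℓ₁ ℓ₂) where
  open RealNumbers ℝ
  open Plane ℝ
  open Supertiles ℝ
  open OrderedFieldProperties orderedField
  open ComplexRing ℝ
  open Recurrence ℝ
  open CR using (refl; sym; trans; +-congʳ; *-congˡ)
  open FibonacciLucas
  open IntegerCoefficients commutativeRing
  private
    module ℂR = CommutativeRing complexRing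

  W : ℕ → ℂ
  W m = fromℕ (fib m) +i √3 * fromℕ (lucas m)

  W-recurrence : ∀ m → W (4 ℕ.+ m) +ᶜ W m ≈ᶜ W (2 ℕ.+ m) +ᶜ W (2 ℕ.+ m) +ᶜ W (2 ℕ.+ m)
  W-recurrence m = cast fib (fib-recurrence m) , (begin
    √3 * fromℕ (lucas (4 ℕ.+ m)) + √3 * fromℕ (lucas m)  ≈⟨ CR.distribˡ √3 _ _ ⟨
    √3 * (fromℕ (lucas (4 ℕ.+ m)) + fromℕ (lucas m))     ≈⟨ *-congˡ (cast lucas (lucas-recurrence m)) ⟩
    √3 * (x + x + x)                                     ≈⟨ ring 2 (λ s x → s :* (x :+ x :+ x) := s :* x :+ s :* x :+ s :* x) refl √3 x ⟩
    √3 * x + √3 * x + √3 * x                             ∎)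
    where
    open SetoidReasoning CR.setoid
    x = fromℕ (lucas (2 ℕ.+ m))
    cast : (u : ℕ → ℕ) → u (4 ℕ.+ m) ℕ.+ u m ≡ u (2 ℕ.+ m) ℕ.+ u (2 ℕ.+ m) ℕ.+ u (2 ℕ.+ m) →
      fromℕ (u (4 ℕ.+ m)) + fromℕ (u m) ≈ fromℕ (u (2 ℕ.+ m)) + fromℕ (u (2 ℕ.+ m)) + fromℕ (u (2 ℕ.+ m))
    cast u eq = trans (sym (fromℕ-+ (u (4 ℕ.+ m)) (u m))) (trans (fromℕ-cong eq)
      (trans (fromℕ-+ (a ℕ.+ a) a) (+-congʳ (fromℕ-+ a a))))
      where a = u (2 ℕ.+ m)

  V-recurrence : ∀ n → V (2 ℕ.+ n) +ᶜ V n ≈ᶜ V (1 ℕ.+ n) +ᶜ V (1 ℕ.+ n) +ᶜ V (1 ℕ.+ n)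
  V-recurrence zero =
      ring 1 (λ s → let x = 1 :× :1; y = (3 :× :1) :* s; x₂ = 3 :× :1 in
        x₂ :+ (((3 :× :1) :* x :- :0 :* y) :- x₂) := x :+ x :+ x) refl √3
    , ring 1 (λ s → let x = 1 :× :1; y = (3 :× :1) :* s; y₂ = (7 :× :1) :* s in
        y₂ :+ (((3 :× :1) :* y :+ :0 :* x) :- y₂) := y :+ y :+ y) refl √3
  V-recurrence (suc k) = supervector-recurrence (markings k) (markings-TailRelation k)

  ClosedFrom : ℕ → ℕ → Set ℓ₁
  ClosedFrom n m = V n ≈ᶜ W m × V (1 ℕ.+ n) ≈ᶜ W (2 ℕ.+ m)

  closedFrom : ∀ n → ClosedFrom n (2 ℕ.* n)
  closedFrom zero =
      ( ring 1 (λ s → ((3 :× :1) :* (1 :× :1) :- :0 :* ((3 :× :1) :* s)) :- 3 :× :1 := :0) refl √3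
      , ring 1 (λ s → ((3 :× :1) :* ((3 :× :1) :* s) :+ :0 :* (1 :× :1)) :- (7 :× :1) :* s := s :* (2 :× :1)) refl √3)
    , (refl , CR.*-comm _ _)
  closedFrom (suc n) = ≡.subst (ClosedFrom (suc n)) (≡.sym (ℕ.*-suc 2 n)) (eq₁ , eq₂)
    where
    m = 2 ℕ.* n
    eq₀ = proj₁ (closedFrom n)
    eq₁ = proj₂ (closedFrom n)
    3eq₁ = ℂR.+-cong (ℂR.+-cong eq₁ eq₁) eq₁
    eq₂ : V (2 ℕ.+ n) ≈ᶜ W (4 ℕ.+ m)
    eq₂ = +ᶜ-cancelʳ (V n) _ _
      (ℂR.trans (V-recurrence n) (ℂR.trans 3eq₁ (ℂR.trans (ℂR.sym (W-recurrence m)) (ℂR.+-congˡ (ℂR.sym eq₀)))))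
      where open GroupProperties ℂR.+-group using () renaming (∙-cancelʳ to +ᶜ-cancelʳ)

module Rotation {c ℓ₁ ℓ₂} (ℝ : RealNumbers c ℓ₁ ℓ₂) (k : ℕ) where
  open RealNumbers ℝ
  open Plane ℝ
  open Supertiles ℝ
  open Trigonometry ℝ
  open OrderedFieldProperties orderedField
  open ComplexRing ℝ
  open ClosedForm ℝ
  open CR using (refl; sym; trans; +-cong; +-congʳ; *-congˡ)
  open FibonacciLucas
  open IntegerCoefficients commutativeRing
  private
    module ℂR = CommutativeRing complexRing
    m = 2 ℕ.* k
    q₀ = 8 ℕ.* lucas (2 ℕ.+ 4 ℕ.* k)
    q = q₀ ℕ.+ 21
    f = fromℕ (fib m)
    l = fromℕ (lucas m)
    f₂ = fromℕ (fib (2 ℕ.+ m))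
    l₂ = fromℕ (lucas (2 ℕ.+ m))
    s = √3
    g = G (suc k)
    θ = arccot (g * s)

    15g : fromℕ 15 * g ≈ fromℕ q
    15g = trans (÷-cancel 14 _) (fromℕ-cong (≡.cong (λ n → 8 ℕ.* lucas (n ℕ.∸ 2) ℕ.+ 21) (ℕ.*-suc 4 k)))

    determinant : l * f₂ ≈ f * l₂ + fromℕ 2
    determinant = begin
      l * f₂                                               ≈⟨ fromℕ-* (lucas m) (fib (2 ℕ.+ m)) ⟨
      fromℕ (lucas m ℕ.* fib (2 ℕ.+ m))                    ≈⟨ fromℕ-cong (fib*lucas-even k) ⟩
      fromℕ (fib m ℕ.* lucas (2 ℕ.+ m) ℕ.+ 2)              ≈⟨ fromℕ-+ (fib m ℕ.* lucas (2 ℕ.+ m)) 2 ⟩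
      fromℕ (fib m ℕ.* lucas (2 ℕ.+ m)) + fromℕ 2          ≈⟨ +-congʳ (fromℕ-* (fib m) (lucas (2 ℕ.+ m))) ⟩
      f * l₂ + fromℕ 2                                     ∎
      where open SetoidReasoning CR.setoid

    2q : fromℕ 2 * fromℕ q ≈ fromℕ 5 * (f * f₂ + fromℕ 3 * (l * l₂))
    2q = begin
      fromℕ 2 * fromℕ q                          ≈⟨ fromℕ-* 2 q ⟨
      fromℕ (2 ℕ.* q)                            ≈⟨ fromℕ-cong (lucas-4k+2 k) ⟩
      fromℕ (5 ℕ.* (ff₂ ℕ.+ 3 ℕ.* ll₂))          ≈⟨ fromℕ-* 5 (ff₂ ℕ.+ 3 ℕ.* ll₂) ⟩
      fromℕ 5 * fromℕ (ff₂ ℕ.+ 3 ℕ.* ll₂)        ≈⟨ *-congˡ (fromℕ-+ ff₂ (3 ℕ.* ll₂)) ⟩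
      fromℕ 5 * (fromℕ ff₂ + fromℕ (3 ℕ.* ll₂))  ≈⟨ *-congˡ (+-cong (fromℕ-* (fib m) (fib (2 ℕ.+ m))) (trans (fromℕ-* 3 ll₂) (*-congˡ (fromℕ-* (lucas m) (lucas (2 ℕ.+ m)))))) ⟩
      fromℕ 5 * (f * f₂ + fromℕ 3 * (l * l₂))    ∎
      where
      open SetoidReasoning CR.setoid
      ff₂ = fib m ℕ.* fib (2 ℕ.+ m)
      ll₂ = lucas m ℕ.* lucas (2 ℕ.+ m)

    6g : fromℕ 6 * g ≈ f * f₂ + fromℕ 3 * (l * l₂)
    6g = *-cancelˡ-positive (0<fromℕ-suc 14) (modulo 15g (fromℕ 6) (modulo 2q (fromℕ 3)
      (ring 3 (λ g q x →
         ((15 :× :1) :* ((6 :× :1) :* g) :+ (6 :× :1) :* q) :+ (3 :× :1) :* ((5 :× :1) :* x)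
      := ((15 :× :1) :* x :+ (6 :× :1) :* ((15 :× :1) :* g)) :+ (3 :× :1) :* ((2 :× :1) :* q))
      refl g (fromℕ q) (f * f₂ + fromℕ 3 * (l * l₂)))))

    0<g : 0# < g
    0<g = positive-factorʳ (0<fromℕ-suc 14) (SPO.<-respʳ-≈ (trans (fromℕ-cong {21 ℕ.+ q₀} {q} (ℕ.+-comm 21 q₀)) (sym 15g)) (0<fromℕ-suc (20 ℕ.+ q₀)))

    0<gs : 0# < g * s
    0<gs = *-positive 0<g 0<√3

    0<θ = arccot-positive 0<gs
    θ<π/2 = arccot-<π/2 0<gs
    0<sinθ = sin-positive 0<θ θ<π/2

    n = fib m ℕ.* fib m ℕ.+ 3 ℕ.* (lucas m ℕ.* lucas m)
    -- The squared norm of V k.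
    N = fromℕ n

    0<N : 0# < N
    0<N = fromℕ-positive (ℕ.<-≤-trans (ℕ.*-mono-< {0} {3} ℕ.z<s (ℕ.*-mono-< (lucas-positive m) (lucas-positive m)))
      (ℕ.m≤n+m _ (fib m ℕ.* fib m)))

    norm : N ≈ f * f + fromℕ 3 * (l * l)
    norm = trans (fromℕ-+ (fib m ℕ.* fib m) _)
      (+-cong (fromℕ-* (fib m) (fib m)) (trans (fromℕ-* 3 (lucas m ℕ.* lucas m)) (*-congˡ (fromℕ-* (lucas m) (lucas m)))))

    N*f₂ : N * f₂ ≈ fromℕ 6 * (f * g + l)
    N*f₂ = modulo norm f₂ (modulo 6g (- f) (modulo determinant (fromℕ 3 * l)
      (ring 6 (λ f l f₂ l₂ g N →
         ((N :* f₂ :+ f₂ :* (f :* f :+ (3 :× :1) :* (l :* l)))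
           :+ (:- f) :* (f :* f₂ :+ (3 :× :1) :* (l :* l₂)))
           :+ ((3 :× :1) :* l) :* (f :* l₂ :+ 2 :× :1)
      := (((6 :× :1) :* (f :* g :+ l) :+ f₂ :* N)
           :+ (:- f) :* ((6 :× :1) :* g))
           :+ ((3 :× :1) :* l) :* (l :* f₂))
      refl f l f₂ l₂ g N)))

    N*l₂ : N * l₂ ≈ fromℕ 6 * (l * g) - fromℕ 2 * f
    N*l₂ = modulo norm l₂ (modulo 6g (- l) (modulo determinant (- f)
      (ring 6 (λ f l f₂ l₂ g N →
         ((N :* l₂ :+ l₂ :* (f :* f :+ (3 :× :1) :* (l :* l)))
           :+ (:- l) :* (f :* f₂ :+ (3 :× :1) :* (l :* l₂)))
           :+ (:- f) :* (f :* l₂ :+ 2 :× :1)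
      := ((((6 :× :1) :* (l :* g) :- (2 :× :1) :* f) :+ l₂ :* N)
           :+ (:- l) :* ((6 :× :1) :* g))
           :+ (:- f) :* (l :* f₂))
      refl f l f₂ l₂ g N)))

    σ = sin θ
    x = cos (- θ)
    y = sin (- θ)

    x≈gsσ : x ≈ (g * s) * σ
    x≈gsσ = trans (cos-neg θ) (cot-arccot 0<gs)

    inv = inverse (*-positive 0<N 0<sinθ)
    i = proj₁ inv
    Nσi≈1 = proj₂ (proj₂ inv)

    -- V (k+1) / V k = 2√3 (g√3 - i) / N, while cis (- θ) = σ (g√3 - i).
    r = fromℕ 2 * s * i

    0<r : 0# < r
    0<r = *-positive (*-positive (0<fromℕ-suc 1) 0<√3) (proj₁ (proj₂ inv))

    rotated : W (2 ℕ.+ m) ≈ᶜ real r *ᶜ (W m *ᶜ cis (- θ))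
    rotated =
        modulo x≈gsσ (- (r * f)) (modulo (sin-neg θ) (r * s * l)
        (modulo √3² (- (fromℕ 2 * i * σ * (f * g + l)))
        (modulo N*f₂ (i * σ) (modulo Nσi≈1 (- f₂)
        (ring 10 (λ f l f₂ g s i σ x y N → let r = (2 :× :1) :* s :* i in
           ((((f₂
             :+ (:- (r :* f)) :* ((g :* s) :* σ))
             :+ (r :* s :* l) :* (:- σ))
             :+ (:- ((2 :× :1) :* i :* σ :* (f :* g :+ l))) :* (3 :× :1))
             :+ (i :* σ) :* ((6 :× :1) :* (f :* g :+ l)))
             :+ (:- f₂) :* :1
        := (((((r :* (f :* x :- (s :* l) :* y) :- :0 :* (f :* y :+ (s :* l) :* x))
             :+ (:- (r :* f)) :* x)
             :+ (r :* s :* l) :* y)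
             :+ (:- ((2 :× :1) :* i :* σ :* (f :* g :+ l))) :* (s :* s))
             :+ (i :* σ) :* (N :* f₂))
             :+ (:- f₂) :* ((N :* σ) :* i))
        refl f l f₂ g s i σ x y N)))))
      , modulo x≈gsσ (- (r * s * l)) (modulo (sin-neg θ) (- (r * f))
        (modulo √3² (- (r * l * g * σ))
        (modulo N*l₂ (s * i * σ) (modulo Nσi≈1 (- (s * l₂))
        (ring 10 (λ f l l₂ g s i σ x y N → let r = (2 :× :1) :* s :* i in
           ((((s :* l₂
             :+ (:- (r :* s :* l)) :* ((g :* s) :* σ))
             :+ (:- (r :* f)) :* (:- σ))
             :+ (:- (r :* l :* g :* σ)) :* (3 :× :1))
             :+ (s :* i :* σ) :* ((6 :× :1) :* (l :* g) :- (2 :× :1) :* f))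
             :+ (:- (s :* l₂)) :* :1
        := (((((r :* (f :* y :+ (s :* l) :* x) :+ :0 :* (f :* x :- (s :* l) :* y))
             :+ (:- (r :* s :* l)) :* x)
             :+ (:- (r :* f)) :* y)
             :+ (:- (r :* l :* g :* σ)) :* (s :* s))
             :+ (s :* i :* σ) :* (N :* l₂))
             :+ (:- (s :* l₂)) :* ((N :* σ) :* i))
        refl f l l₂ g s i σ x y N)))))

  rotation-angle : IsClockwiseAngle (arccot (G (suc k) * √3)) (V k) (V (suc k))
  rotation-angle = <⇒≤ 0<θ , x<π/2⇒x<2π θ<π/2 , r , 0<r ,
    ℂR.trans (proj₂ (closedFrom k)) (ℂR.trans rotated
      (ℂR.*-congˡ {real r} (ℂR.*-congʳ {cis (- θ)} (ℂR.sym (proj₁ (closedFrom k))))))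

mainTheorem1 : ∀ {c ℓ₁ ℓ₂} (ℝ : RealNumbers c ℓ₁ ℓ₂) →
  let open RealNumbers ℝ
      open Plane ℝ
      open Supertiles ℝ
  in (∀ n → V n ≈ᶜ (fromℕ (fib (2 ℕ.* n)) +i √3 * fromℕ (lucas (2 ℕ.* n))))
     × (∀ n → 1 ℕ.≤ n → IsClockwiseAngle (arccot (G n * √3)) (V (n ℕ.∸ 1)) (V n))
mainTheorem1 ℝ =
    (λ n → proj₁ (ClosedForm.closedFrom ℝ n))
  , λ { (suc k) _ → Rotation.rotation-angle ℝ k }
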